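{- Let $T$ be a complete consistent first-order theory in a language $\mathcal L$, and work in $T^{\mathrm{eq}}$. For all sets $A,B,C$: $A\perp^{\text{þ}}_CB$ (thorn-forking independence defined via M-dividing) if and only if for every tuple $a\in A$, every tuple $b\in BC$ and every $\mathcal L$-formula $\varphi(x,y)$ such that $\models\varphi(a,b)$, the formula $\varphi(x,b)$ does not þ-fork over $C$ in the sense of Onshuus.
   Context: Everything is computed in a big saturated model of $T^{\mathrm{eq}}$ (so formulas and elements are those of $T^{\mathrm{eq}}$, and $\operatorname{acl}$ is $\operatorname{acl}^{\mathrm{eq}}$). All sets are small; $BC$ means $B\cup C$; $a\in A$ for a tuple $a$ means that all its entries lie in $A$. $A\equiv_BA'$ means that some automorphism fixing $B$ pointwise maps the set $A$ onto $A'$. M-dividing independence: $A\perp^M_CB$ iff $\operatorname{acl}(AC')\cap\operatorname{acl}(BC')=\operatorname{acl}C'$ for every $C'$ with $C\subseteq C'\subseteq\operatorname{acl}(BC)$. Thorn-forking independence: $A\perp^{\text{þ}}_CB$ iff for all $\hat B\supseteq B$ there is $A'\equiv_{BC}A$ such that $A'\perp^M_C\hat B$. Onshuus' definition: let $\varphi(x,y)$ be a formula without parameters, $b$ an element (or finite tuple), $C$ a set. - $\varphi(x,b)$ strongly divides over $C$ if $\operatorname{tp}(b/C)$ is not algebraic and $\{\varphi(x,b')\mid b'\models\operatorname{tp}(b/C)\}$ is $k$-inconsistent for some $k<\omega$ (i.e. for any $k$ distinct realisations $b'$ of $\operatorname{tp}(b/C)$ the corresponding formulas are jointly inconsistent;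 logically equivalent formulas with different parameters are not identified). - $\varphi(x,b)$ þ-divides over $C$ if there is a tuple $c$ such that $\varphi(x,b)$ strongly divides over $Cc$. - $\varphi(x,b)$ þ-forks over $C$ if it implies a finite disjunction of formulas (with arbitrary parameters), each of which þ-divides over $C$. -}

module Defs where

open import Level using (Level; _⊔_; suc)
open import Data.Empty.Polymorphic using (⊥)
open import Data.Fin.Base using (Fin)
open import Data.List.Base using (List; []; _∷_; _++_; map)
open import Data.List.Membership.Propositional using () renaming (_∈_ to _∈ₗ_)
open import Data.List.Relation.Unary.All as All using (All; []; _∷_)
open import Data.List.Relation.Unary.All.Properties using (map⁺; map⁻; ++⁺)
open import Data.List.Relation.Unary.Any using (Any)
open import Data.Nat.Base using (ℕ)
open import Data.Product.Base using (Σ; Σ-syntax; ∃; ∃-syntax; _×_; _,_)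
open import Data.Sum.Base using (_⊎_)
open import Function.Base using (_∘_)
open import Function.Bundles using (_⇔_; _↔_; Inverse)
open import Function.Definitions using (Injective)
open import Relation.Binary.PropositionalEquality.Core using (_≡_)
open import Relation.Binary.Structures using (IsEquivalence)
open import Relation.Nullary.Negation.Core using (¬_)
open import Relation.Unary using (Pred; _∈_; _⊆_; _∪_; _∩_; _≐_)

-- Many-sorted, since T^eq is; the one-sorted case is Sort = ⊤.
record Language (κ : Level) : Set (suc κ) where
  field
    Sort : Set κ
    Fun  : List Sort → Sort → Set κ
    Rel  : List Sort → Set κ

module _ {κ : Level} (L : Language κ) where
  open Language L

  -- A term or formula over Γ has its free variables in the list Γ of
  -- sorts (de Bruijn, innermost variable first).

  data Term (Γ : List Sort) : Sort → Set κ where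
    var : ∀ {σ} → σ ∈ₗ Γ → Term Γ σ
    app : ∀ {Δ σ} → Fun Δ σ → All (Term Γ) Δ → Term Γ σ

  data Formula (Γ : List Sort) : Set κ where
    eq           : ∀ {σ} → Term Γ σ → Term Γ σ → Formula Γ
    rel          : ∀ {Δ} → Rel Δ → All (Term Γ) Δ → Formula Γ
    false        : Formula Γ
    _and_ _or_ _imp_ : Formula Γ → Formula Γ → Formula Γ
    all ex       : ∀ σ → Formula (σ ∷ Γ) → Formula Γ

  Sentence : Set κ
  Sentence = Formula []

  Theory : Set (suc κ)
  Theory = Pred Sentence κ

  record Structure (m : Level) : Set (κ ⊔ suc m) where
    field
      Carrier  : Sort → Set m
      nonempty : ∀ σ → Carrier σ
      ⟦_⟧ᶠ     : ∀ {Γ σ} → Fun Γ σ → All Carrier Γ → Carrier σ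
      ⟦_⟧ʳ     : ∀ {Γ} → Rel Γ → All Carrier Γ → Set m

neg : ∀ {κ} {L : Language κ} {Γ} → Formula L Γ → Formula L Γ
neg φ = φ imp false

module _ {κ m : Level} {L : Language κ} (M : Structure L m) where
  open Language L
  open Structure M

  eval  : ∀ {Γ σ} → Term L Γ σ → All Carrier Γ → Carrier σ
  evals : ∀ {Γ Δ} → All (Term L Γ) Δ → All Carrier Γ → All Carrier Δ
  eval (var i)    a = All.lookup a i
  eval (app f ts) a = ⟦ f ⟧ᶠ (evals ts a)
  evals []       a = []
  evals (t ∷ ts) a = eval t a ∷ evals ts a

  Sat : ∀ {Γ} → Formula L Γ → All Carrier Γ → Set m
  Sat (eq s t)   a = eval s a ≡ eval t a
  Sat (rel R ts) a = ⟦ R ⟧ʳ (evals ts a)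
  Sat false      a = ⊥
  Sat (φ and ψ)  a = Sat φ a × Sat ψ a
  Sat (φ or ψ)   a = Sat φ a ⊎ Sat ψ a
  Sat (φ imp ψ)  a = Sat φ a → Sat ψ a
  Sat (all σ φ)  a = (x : Carrier σ) → Sat φ (x ∷ a)
  Sat (ex σ φ)   a = Σ[ x ∈ Carrier σ ] Sat φ (x ∷ a)

_⊨_ : ∀ {κ m} {L : Language κ} → Structure L m → Theory L → Set (κ ⊔ m)
M ⊨ T = ∀ φ → φ ∈ T → Sat M φ []

-- Consistency and consequence are semantic.  Models with carriers in
-- Set κ suffice by Löwenheim–Skolem, since L is in Set κ.
module _ {κ : Level} {L : Language κ} (T : Theory L) where
  open Language L

  Consistent : Set (suc κ)
  Consistent = Σ[ M ∈ Structure L κ ] M ⊨ T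

  Entails : Sentence L → Set (suc κ)
  Entails φ = (M : Structure L κ) → M ⊨ T → Sat M φ []

  Complete : Set (suc κ)
  Complete = (φ : Sentence L) → Entails φ ⊎ Entails (neg φ)

  ProvablyEquivalence : ∀ Γ → Formula L (Γ ++ Γ) → Set (suc κ)
  ProvablyEquivalence Γ E = (M : Structure L κ) → M ⊨ T →
    IsEquivalence (λ (x y : All (Structure.Carrier M) Γ) → Sat M E (++⁺ x y))

  -- A sort for L's own sorts, and one for each ∅-definable equivalence
  -- relation on tuples.  The proof that E is an equivalence relation is
  -- irrelevant, so that E determines its sort.
  data EqSort : Set (suc κ) where
    home : Sort → EqSort
    quot : ∀ Γ (E : Formula L (Γ ++ Γ)) → .(ProvablyEquivalence Γ E) → EqSort

  data EqFun : List EqSort → EqSort → Set (suc κ) where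
    home : ∀ {Γ σ} → Fun Γ σ → EqFun (map home Γ) (home σ)
    proj : ∀ Γ (E : Formula L (Γ ++ Γ)) .(e : ProvablyEquivalence Γ E) →
           EqFun (map home Γ) (quot Γ E e)

  data EqRel : List EqSort → Set (suc κ) where
    home : ∀ {Γ} → Rel Γ → EqRel (map home Γ)

  Eq : Language (suc κ)
  Eq = record { Sort = EqSort ; Fun = EqFun ; Rel = EqRel }

  module _ {m : Level} (N : Structure Eq m) where
    private module N = Structure N

    reduct : Structure L m
    reduct = record
      { Carrier  = N.Carrier ∘ home
      ; nonempty = N.nonempty ∘ home
      ; ⟦_⟧ᶠ     = λ f xs → N.⟦ home f ⟧ᶠ (map⁺ xs)
      ; ⟦_⟧ʳ     = λ R xs → N.⟦ home R ⟧ʳ (map⁺ xs)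
      }

    -- The axioms of T^eq, read in N: those of T for the home sorts, and
    -- that each projection is onto with kernel E.
    record IsModelOfEq : Set (suc κ ⊔ m) where
      field
        home-⊨    : reduct ⊨ T
        proj-onto : ∀ Γ E .(e : ProvablyEquivalence Γ E) (y : N.Carrier (quot Γ E e)) →
                    Σ[ x ∈ All (N.Carrier ∘ home) Γ ] N.⟦ proj Γ E e ⟧ᶠ (map⁺ x) ≡ y
        proj-ker  : ∀ Γ E .(e : ProvablyEquivalence Γ E) (x y : All (N.Carrier ∘ home) Γ) →
                    N.⟦ proj Γ E e ⟧ᶠ (map⁺ x) ≡ N.⟦ proj Γ E e ⟧ᶠ (map⁺ y) ⇔
                    Sat reduct E (++⁺ x y)

module Big {κ m : Level} {L : Language κ} (N : Structure L m) where
  open Language L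
  open Structure N

  Tuple : List Sort → Set (κ ⊔ m)
  Tuple = All Carrier

  Elem : Set (κ ⊔ m)
  Elem = Σ Sort Carrier

  Subset : Set (suc (κ ⊔ m))
  Subset = Pred Elem (κ ⊔ m)

  entries : ∀ {Γ} → Tuple Γ → Subset
  entries {Γ} a (σ , x) = Σ[ i ∈ σ ∈ₗ Γ ] All.lookup a i ≡ x

  -- The universe Set κ plays the role of the cardinal bounding small sets.
  Small : Subset → Set (suc κ ⊔ m)
  Small A = Σ[ I ∈ Set κ ] Σ[ f ∈ (I → Elem) ] A ≐ (λ e → ∃[ i ] f i ≡ e)

  -- The formula φ(x,b) in variables x of sorts Γ.
  record Instance (Γ : List Sort) : Set (κ ⊔ m) where
    constructor _[-,_]
    field
      {paramSorts} : List Sort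
      formula      : Formula L (Γ ++ paramSorts)
      params       : Tuple paramSorts

  open Instance

  infix 4 _⊩_
  _⊩_ : ∀ {Γ} → Tuple Γ → Instance Γ → Set m
  a ⊩ φ = Sat N (formula φ) (++⁺ a (params φ))

  Over : ∀ {Γ} → Subset → Instance Γ → Set (κ ⊔ m)
  Over C φ = entries (params φ) ⊆ C

  record Automorphism : Set (κ ⊔ m) where
    field
      bij : ∀ σ → Carrier σ ↔ Carrier σ

    to : ∀ {σ} → Carrier σ → Carrier σ
    to {σ} = Inverse.to (bij σ)

    field
      preserves-fun : ∀ {Γ σ} (f : Fun Γ σ) (a : Tuple Γ) →
                      to (⟦ f ⟧ᶠ a) ≡ ⟦ f ⟧ᶠ (All.map to a)
      preserves-rel : ∀ {Γ} (R : Rel Γ) (a : Tuple Γ) →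
                      ⟦ R ⟧ʳ a ⇔ ⟦ R ⟧ʳ (All.map to a)

    image : Subset → Subset
    image A (σ , y) = Σ[ x ∈ Carrier σ ] (σ , x) ∈ A × to x ≡ y

  module _ {X : Set κ} (s : X → Sort) where

    Family : Set (κ ⊔ m)
    Family = (x : X) → Carrier (s x)

    _at_ : Family → (xs : List X) → Tuple (map s xs)
    f at xs = map⁺ (All.universal f xs)

    FamilyInstance : Set (κ ⊔ m)
    FamilyInstance = Σ[ xs ∈ List X ] Instance (map s xs)

    Realises : Family → FamilyInstance → Set m
    Realises f (xs , φ) = f at xs ⊩ φ

    OverF : Subset → FamilyInstance → Set (κ ⊔ m)
    OverF C (_ , φ) = Over C φ

    FinitelySatisfiable : Pred FamilyInstance (κ ⊔ m) → Set (κ ⊔ m)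
    FinitelySatisfiable p =
      ∀ φs → All (_∈ p) φs → Σ[ f ∈ Family ] All (Realises f) φs

    SameType : Family → Family → Set (κ ⊔ m)
    SameType f g = ∀ xs (φ : Formula L (map s xs)) →
      Sat N φ (f at xs) ⇔ Sat N φ (g at xs)

  -- Types may have a small family of variables, not only finitely many;
  -- for κ-saturation with |C| < κ this is equivalent.
  Saturated : Set (suc (κ ⊔ m))
  Saturated =
    ∀ {X : Set κ} (s : X → Sort) (C : Subset) → Small C →
    (p : Pred (FamilyInstance s) (κ ⊔ m)) → p ⊆ OverF s C →
    FinitelySatisfiable s p →
    Σ[ f ∈ Family s ] (∀ φ → φ ∈ p → Realises s f φ)

  StronglyHomogeneous : Set (suc κ ⊔ m)
  StronglyHomogeneous =
    ∀ {X : Set κ} (s : X → Sort) (f g : Family s) → SameType s f g →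
    Σ[ h ∈ Automorphism ] (∀ x → Automorphism.to h (f x) ≡ g x)

  -- A ≡[ B ] A′ : as sets, not as enumerated tuples.
  _≡[_]_ : Subset → Subset → Subset → Set (κ ⊔ m)
  A ≡[ B ] A′ = Σ[ h ∈ Automorphism ]
    (∀ {σ} (x : Carrier σ) → (σ , x) ∈ B → Automorphism.to h x ≡ x) ×
    Automorphism.image h A ≐ A′

  -- b′ ⊨ tp(b/C)
  RealisesType : ∀ {Γ} → Tuple Γ → Subset → Tuple Γ → Set (κ ⊔ m)
  RealisesType {Γ} b C b′ = (φ : Instance Γ) → Over C φ → b ⊩ φ → b′ ⊩ φ

  Finite : ∀ {Γ} → Instance Γ → Set (κ ⊔ m)
  Finite {Γ} φ = Σ[ as ∈ List (Tuple Γ) ] (∀ a → a ⊩ φ → a ∈ₗ as)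

  Algebraic : ∀ {Γ} → Tuple Γ → Subset → Set (κ ⊔ m)
  Algebraic {Γ} b C = Σ[ φ ∈ Instance Γ ] Over C φ × b ⊩ φ × Finite φ

  acl : Subset → Subset
  acl A (σ , x) = Algebraic (x ∷ []) A

  _⊥ᴹ[_]_ : Subset → Subset → Subset → Set (suc (κ ⊔ m))
  A ⊥ᴹ[ C ] B = (C′ : Subset) → C ⊆ C′ → C′ ⊆ acl (B ∪ C) →
    (acl (A ∪ C′) ∩ acl (B ∪ C′)) ≐ acl C′

  _⊥þ[_]_ : Subset → Subset → Subset → Set (suc (κ ⊔ m))
  A ⊥þ[ C ] B = (B̂ : Subset) → Small B̂ → B ⊆ B̂ →
    Σ[ A′ ∈ Subset ] A′ ≡[ B ∪ C ] A × A′ ⊥ᴹ[ C ] B̂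

  -- {φ(x,b′) ∣ b′ ⊨ tp(b/C)} is k-inconsistent, counting distinct
  -- parameters b′ as distinct formulas.
  Inconsistent : ∀ {Γ} → ℕ → Instance Γ → Subset → Set (κ ⊔ m)
  Inconsistent {Γ} k (φ [-, b ]) C =
    (b′ : Fin k → Tuple _) → Injective _≡_ _≡_ b′ →
    (∀ i → RealisesType b C (b′ i)) →
    ¬ (Σ[ a ∈ Tuple Γ ] ∀ i → a ⊩ φ [-, b′ i ])

  StronglyDivides : ∀ {Γ} → Instance Γ → Subset → Set (κ ⊔ m)
  StronglyDivides φ C = ¬ Algebraic (params φ) C × ∃[ k ] Inconsistent k φ C

  ÞDivides : ∀ {Γ} → Instance Γ → Subset → Set (κ ⊔ m)
  ÞDivides φ C = Σ[ Δ ∈ List Sort ] Σ[ c ∈ Tuple Δ ] StronglyDivides φ (C ∪ entries c)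

  ÞForks : ∀ {Γ} → Instance Γ → Subset → Set (κ ⊔ m)
  ÞForks {Γ} φ C = Σ[ ψs ∈ List (Instance Γ) ]
    All (λ ψ → ÞDivides ψ C) ψs × (∀ a → a ⊩ φ → Any (a ⊩_) ψs)

{-# OPTIONS --safe #-}

-- If ψ(x,d) strongly divides over Cc and holds of a′, then by saturation d is
-- algebraic over Cca′; were A′ M-independent over C from a set containing c
-- and d, then d would be algebraic over Cc.  So an M-independent conjugate of
-- A satisfies no member of a forking disjunction whose parameters and
-- witnesses c have been put into B̂.
--
-- Conversely, by compactness and homogeneity A has a conjugate A′ over BC
-- that satisfies no þ-dividing formula over a small set containing the
-- relevant algebraic closures.  If x lies in acl(A′C′) and acl(B̂C′) but not
-- in acl(C′), where χ(z,a,c) has at most n solutions and x is one of them,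
-- then χ(x,y,c) ∧ ∃≤n z χ(z,y,c) is such a formula, true of a ∈ A′.
module Submission where

open import Defs
open import Axiom.ExcludedMiddle using (ExcludedMiddle)
open import Data.Empty.Polymorphic using (⊥-elim)
open import Data.Fin.Base using (Fin; zero; suc)
open import Data.Fin.Properties using (pigeonhole; <⇒≢)
open import Data.List.Base
  using (List; []; _∷_; _++_; map; length; lookup; foldr; tabulate; concatMap; cartesianProductWith)
open import Data.List.Membership.Propositional using () renaming (_∈_ to _∈ₗ_; _∉_ to _∉ₗ_)
open import Data.List.Membership.Propositional.Properties
  using (∈-++⁺ˡ; ∈-++⁺ʳ; ∈-map⁺; ∈-cartesianProductWith⁺; ∈-tabulate⁺)
open import Data.List.Relation.Unary.All as All using (All; []; _∷_)
open import Data.List.Relation.Unary.All.Properties using (++⁺; lookup-map)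
open import Data.List.Relation.Unary.Any as Any using (Any; here; there)
open import Data.List.Relation.Unary.Any.Properties using (lookup-index)
open import Data.Nat.Base using (ℕ; zero; suc)
open import Data.Nat.Properties using (n<1+n)
open import Data.Product.Base using (Σ; Σ-syntax; ∃-syntax; _×_; _,_; proj₁; proj₂; map₂)
open import Data.Product.Function.NonDependent.Propositional using (_×-⇔_)
open import Data.Sum.Base using (_⊎_; inj₁; inj₂; [_,_])
open import Data.Sum.Function.Propositional using (_⊎-⇔_)
open import Function.Base using (_∘_; id)
open import Function.Bundles using (_⇔_; mk⇔; module Equivalence; module Inverse)
open import Function.Definitions using (Injective)
open import Function.Construct.Identity using (⇔-id)
open import Function.Related.TypeIsomorphisms using (→-cong-⇔)
open import Level using (Level; _⊔_)
open import Relation.Binary.PropositionalEquality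
  using (_≡_; _≢_; refl; sym; trans; cong; cong₂; subst)
open import Relation.Nullary.Decidable.Core using (yes; no; decidable-stable)
open import Relation.Nullary.Negation.Core using (¬_; contradiction)
open import Relation.Unary using (Pred; _∈_; _∉_; _⊆_; _∪_; _≐_)

open Equivalence using (to; from)

-- Renamings

module _ {s : Level} {S : Set s} where

  infix 4 _⇒_
  _⇒_ : List S → List S → Set s
  Γ ⇒ Δ = ∀ {σ} → σ ∈ₗ Γ → σ ∈ₗ Δ

  lift : ∀ {Γ Δ σ} → Γ ⇒ Δ → (σ ∷ Γ) ⇒ (σ ∷ Δ)
  lift ρ (here p)  = here p
  lift ρ (there i) = there (ρ i)

  copair : ∀ Γ {Δ Θ} → Γ ⇒ Θ → Δ ⇒ Θ → (Γ ++ Δ) ⇒ Θ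
  copair []      ρ ρ′ i         = ρ′ i
  copair (σ ∷ Γ) ρ ρ′ (here p)  = ρ (here p)
  copair (σ ∷ Γ) ρ ρ′ (there i) = copair Γ (ρ ∘ there) ρ′ i

  single : ∀ {Γ σ} → σ ∈ₗ Γ → (σ ∷ []) ⇒ Γ
  single i (here refl) = i

  module _ {c : Level} {F : S → Set c} where

    -- Agreement entry by entry along `ρ` replaces equations between tuples, so that permuting,
    -- regrouping or repeating variables never needs a transport along equal contexts.
    infix 4 _≈[_]_
    _≈[_]_ : ∀ {Γ Δ} → All F Γ → Γ ⇒ Δ → All F Δ → Set (s ⊔ c)
    b ≈[ ρ ] a = ∀ {σ} (i : σ ∈ₗ _) → All.lookup b i ≡ All.lookup a (ρ i)

    ≈-lift : ∀ {Γ Δ σ} {ρ : Γ ⇒ Δ} {b a} {x : F σ} → b ≈[ ρ ] a → x ∷ b ≈[ lift ρ ] x ∷ a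
    ≈-lift e (here refl) = refl
    ≈-lift e (there i)   = e i

    ≈-copair : ∀ {Γ Δ Θ} {ρ : Γ ⇒ Θ} {ρ′ : Δ ⇒ Θ} (a : All F Γ) {b c} →
               a ≈[ ρ ] c → b ≈[ ρ′ ] c → ++⁺ a b ≈[ copair Γ ρ ρ′ ] c
    ≈-copair []      e e′ i           = e′ i
    ≈-copair (x ∷ a) e e′ (here refl) = e (here refl)
    ≈-copair (x ∷ a) {b} {c} e e′ (there i) = ≈-copair a {b} {c} (e ∘ there) e′ i

    ≈-single : ∀ {Γ σ} {a : All F Γ} {x} (i : σ ∈ₗ Γ) → x ≡ All.lookup a i → x ∷ [] ≈[ single i ] a
    ≈-single i e (here refl) = e

    lookup-++⁺ˡ : ∀ {Γ Δ} (a : All F Γ) (b : All F Δ) → a ≈[ ∈-++⁺ˡ ] ++⁺ a b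
    lookup-++⁺ˡ (x ∷ a) b (here refl) = refl
    lookup-++⁺ˡ (x ∷ a) b (there i)   = lookup-++⁺ˡ a b i

    lookup-++⁺ʳ : ∀ {Γ Δ} (a : All F Γ) (b : All F Δ) → b ≈[ ∈-++⁺ʳ Γ ] ++⁺ a b
    lookup-++⁺ʳ []      b i = refl
    lookup-++⁺ʳ (x ∷ a) b i = lookup-++⁺ʳ a b i

    lookup-tabulate : ∀ Γ (f : ∀ {σ} → σ ∈ₗ Γ → F σ) {σ} (i : σ ∈ₗ Γ) →
                      All.lookup (All.tabulate f) i ≡ f i
    lookup-tabulate (σ ∷ Γ) f (here refl) = refl
    lookup-tabulate (σ ∷ Γ) f (there i)   = lookup-tabulate Γ (f ∘ there) i

  positions : (Γ : List S) → List (∃[ σ ] σ ∈ₗ Γ)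
  positions []      = []
  positions (σ ∷ Γ) = (σ , here refl) ∷ map (map₂ there) (positions Γ)

  ∈-positions : ∀ {Γ : List S} {σ} (i : σ ∈ₗ Γ) → (σ , i) ∈ₗ positions Γ
  ∈-positions (here refl) = here refl
  ∈-positions (there i)   = there (∈-map⁺ (map₂ there) (∈-positions i))

-- Renamed formulas, blocks of quantifiers and counting formulas

module _ {κ : Level} {L : Language κ} where
  open Language L

  renᵗ  : ∀ {Γ Δ σ} → Γ ⇒ Δ → Term L Γ σ → Term L Δ σ
  renᵗˢ : ∀ {Γ Δ Θ} → Γ ⇒ Δ → All (Term L Γ) Θ → All (Term L Δ) Θ
  renᵗ ρ (var i)    = var (ρ i)
  renᵗ ρ (app f ts) = app f (renᵗˢ ρ ts)
  renᵗˢ ρ []       = []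
  renᵗˢ ρ (t ∷ ts) = renᵗ ρ t ∷ renᵗˢ ρ ts

  ren : ∀ {Γ Δ} → Γ ⇒ Δ → Formula L Γ → Formula L Δ
  ren ρ (eq s t)   = eq (renᵗ ρ s) (renᵗ ρ t)
  ren ρ (rel R ts) = rel R (renᵗˢ ρ ts)
  ren ρ false      = false
  ren ρ (φ and ψ)  = ren ρ φ and ren ρ ψ
  ren ρ (φ or ψ)   = ren ρ φ or ren ρ ψ
  ren ρ (φ imp ψ)  = ren ρ φ imp ren ρ ψ
  ren ρ (all σ φ)  = all σ (ren (lift ρ) φ)
  ren ρ (ex σ φ)   = ex σ (ren (lift ρ) φ)

  exs : ∀ Γ {Δ} → Formula L (Γ ++ Δ) → Formula L Δ
  exs []      φ = φ
  exs (σ ∷ Γ) φ = exs Γ (ex σ φ)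

  -- The quantifier "at most `n`", by removing one point at a time. The removed point need not be a
  -- solution, so having fewer solutions is no separate case.
  atMost : ∀ {Γ σ} → ℕ → Formula L (σ ∷ Γ) → Formula L Γ
  atMost {σ = σ} zero    φ = neg (ex σ φ)
  atMost {σ = σ} (suc n) φ = ex σ (atMost n
    (ren (lift there) φ and neg (eq (var (here refl)) (var (there (here refl))))))

module _ {a p q : Level} {A : Set a} {P : A → Set p} {Q : A → Set q} where

  Π-cong-⇔ : (∀ x → P x ⇔ Q x) → (∀ x → P x) ⇔ (∀ x → Q x)
  Π-cong-⇔ e = mk⇔ (λ f x → to (e x) (f x)) (λ f x → from (e x) (f x))

  Σ-cong-⇔ : (∀ x → P x ⇔ Q x) → Σ A P ⇔ Σ A Q
  Σ-cong-⇔ e = mk⇔ (map₂ (to (e _))) (map₂ (from (e _)))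

-- Truth under renamings and automorphisms

module _ {κ m : Level} {L : Language κ} (N : Structure L m) where
  open Language L
  open Structure N

  eval-ren  : ∀ {Γ Δ σ} (ρ : Γ ⇒ Δ) (t : Term L Γ σ) {b a} → b ≈[ ρ ] a →
              eval N t b ≡ eval N (renᵗ ρ t) a
  evals-ren : ∀ {Γ Δ Θ} (ρ : Γ ⇒ Δ) (ts : All (Term L Γ) Θ) {b a} → b ≈[ ρ ] a →
              evals N ts b ≡ evals N (renᵗˢ ρ ts) a
  eval-ren ρ (var i)    e = e i
  eval-ren ρ (app f ts) e = cong ⟦ f ⟧ᶠ (evals-ren ρ ts e)
  evals-ren ρ []       e = refl
  evals-ren ρ (t ∷ ts) e = cong₂ _∷_ (eval-ren ρ t e) (evals-ren ρ ts e)

  Sat-ren : ∀ {Γ Δ} (ρ : Γ ⇒ Δ) (φ : Formula L Γ) {b a} → b ≈[ ρ ] a →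
            Sat N φ b ⇔ Sat N (ren ρ φ) a
  Sat-ren ρ (eq s t)   {b} {a} e rewrite eval-ren ρ s {b} {a} e | eval-ren ρ t {b} {a} e = ⇔-id _
  Sat-ren ρ (rel R ts) {b} {a} e rewrite evals-ren ρ ts {b} {a} e = ⇔-id _
  Sat-ren ρ false      e = ⇔-id _
  Sat-ren ρ (φ and ψ)  e = Sat-ren ρ φ e ×-⇔ Sat-ren ρ ψ e
  Sat-ren ρ (φ or ψ)   e = Sat-ren ρ φ e ⊎-⇔ Sat-ren ρ ψ e
  Sat-ren ρ (φ imp ψ)  e = →-cong-⇔ (Sat-ren ρ φ e) (Sat-ren ρ ψ e)
  Sat-ren ρ (all σ φ)  e = Π-cong-⇔ λ x → Sat-ren (lift ρ) φ (≈-lift e)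
  Sat-ren ρ (ex σ φ)   e = Σ-cong-⇔ λ x → Sat-ren (lift ρ) φ (≈-lift e)

  Sat-exs : ∀ Γ {Δ} (φ : Formula L (Γ ++ Δ)) (b : All Carrier Δ) →
            Sat N (exs Γ φ) b ⇔ (Σ[ a ∈ All Carrier Γ ] Sat N φ (++⁺ a b))
  Sat-exs []      φ b = mk⇔ ([] ,_) λ { ([] , h) → h }
  Sat-exs (σ ∷ Γ) φ b = mk⇔
    (λ h → let (a , x , s) = to (Sat-exs Γ (ex σ φ) b) h in x ∷ a , s)
    λ { (x ∷ a , s) → from (Sat-exs Γ (ex σ φ) b) (a , x , s) }

  module _ (em : ∀ {p} → ExcludedMiddle p) where

    -- The list may repeat entries and contain non-solutions; this is why length exactly `n`
    -- expresses a bound. Excluded middle decides whether a solution is the point `w` just removed.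
    Sat-atMost : ∀ {Γ σ} n (φ : Formula L (σ ∷ Γ)) (a : All Carrier Γ) →
                 Sat N (atMost n φ) a ⇔
                 (Σ[ xs ∈ List (Carrier σ) ] length xs ≡ n × (∀ z → Sat N φ (z ∷ a) → z ∈ₗ xs))
    Sat-atMost zero φ a = mk⇔
      (λ h → [] , refl , λ z s → ⊥-elim (h (z , s)))
      λ { ([] , _ , h) (z , s) → contradiction (h z s) λ () }
    Sat-atMost {σ = σ} (suc n) φ a = mk⇔ f g
      where
      φ≢ = ren (lift there) φ and neg (eq (var (here refl)) (var (there (here refl))))
      shift : ∀ z w → Sat N φ (z ∷ a) ⇔ Sat N (ren (lift there) φ) (z ∷ w ∷ a)
      shift z w = Sat-ren (lift there) φ (≈-lift λ i → refl)
      f : Sat N (atMost (suc n) φ) a → _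
      f (w , h) with xs , refl , cover ← to (Sat-atMost n φ≢ (w ∷ a)) h = w ∷ xs , refl , cover′
        where
        cover′ : ∀ z → Sat N φ (z ∷ a) → z ∈ₗ w ∷ xs
        cover′ z s with em {P = z ≡ w}
        ... | yes z≡w = here z≡w
        ... | no  z≢w = there (cover z (to (shift z w) s , λ z≡w → contradiction z≡w z≢w))
      g : _ → Sat N (atMost (suc n) φ) a
      g (w ∷ xs , refl , cover) = w , from (Sat-atMost n φ≢ (w ∷ a)) (xs , refl , λ z (s , z≢w) →
        Any.tail (⊥-elim ∘ z≢w) (cover z (from (shift z w) s)))

  module _ (h : Big.Automorphism N) where
    open Big.Automorphism h renaming (to to ⟦h⟧)

    eval-automorphism  : ∀ {Γ σ} (t : Term L Γ σ) a → ⟦h⟧ (eval N t a) ≡ eval N t (All.map ⟦h⟧ a)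
    evals-automorphism : ∀ {Γ Δ} (ts : All (Term L Γ) Δ) a →
                         All.map ⟦h⟧ (evals N ts a) ≡ evals N ts (All.map ⟦h⟧ a)
    eval-automorphism (var i)    a = sym (lookup-map a i)
    eval-automorphism (app f ts) a =
      trans (preserves-fun f (evals N ts a)) (cong ⟦ f ⟧ᶠ (evals-automorphism ts a))
    evals-automorphism []       a = refl
    evals-automorphism (t ∷ ts) a = cong₂ _∷_ (eval-automorphism t a) (evals-automorphism ts a)

    Sat-automorphism : ∀ {Γ} (φ : Formula L Γ) a → Sat N φ a ⇔ Sat N φ (All.map ⟦h⟧ a)
    Sat-automorphism (eq s t)   a
      rewrite sym (eval-automorphism s a) | sym (eval-automorphism t a) =
      mk⇔ (cong ⟦h⟧) (λ e → trans (sym (Inverse.strictlyInverseʳ (bij _) _))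
        (trans (cong (Inverse.from (bij _)) e) (Inverse.strictlyInverseʳ (bij _) _)))
    Sat-automorphism (rel R ts) a rewrite sym (evals-automorphism ts a) = preserves-rel R _
    Sat-automorphism false      a = ⇔-id _
    Sat-automorphism (φ and ψ)  a = Sat-automorphism φ a ×-⇔ Sat-automorphism ψ a
    Sat-automorphism (φ or ψ)   a = Sat-automorphism φ a ⊎-⇔ Sat-automorphism ψ a
    Sat-automorphism (φ imp ψ)  a = →-cong-⇔ (Sat-automorphism φ a) (Sat-automorphism ψ a)
    Sat-automorphism (all σ φ)  a = mk⇔
      (λ s y → subst (λ z → Sat N φ (z ∷ _)) (Inverse.strictlyInverseˡ (bij σ) y)
        (to (Sat-automorphism φ (_ ∷ a)) (s (Inverse.from (bij σ) y))))
      (λ s x → from (Sat-automorphism φ (x ∷ a)) (s (⟦h⟧ x)))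
    Sat-automorphism (ex σ φ)   a = mk⇔
      (λ (x , s) → ⟦h⟧ x , to (Sat-automorphism φ (x ∷ a)) s)
      (λ (y , s) → Inverse.from (bij σ) y , from (Sat-automorphism φ (_ ∷ a))
        (subst (λ z → Sat N φ (z ∷ _)) (sym (Inverse.strictlyInverseˡ (bij σ) y)) s))

-- Instances and algebraicity

module _ {κ m : Level} {L : Language κ} (N : Structure L m) where
  open Language L
  open Structure N
  open Big N
  open Instance

  ⊤ᵢ : ∀ {Γ} → Instance Γ
  ⊤ᵢ = (false imp false) [-, [] ]

  ¬ᵢ_ : ∀ {Γ} → Instance Γ → Instance Γ
  ¬ᵢ (φ [-, b ]) = neg φ [-, b ]

  renᵢ : ∀ {Γ Δ} → Γ ⇒ Δ → Instance Γ → Instance Δ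
  renᵢ {Γ} ρ (φ [-, b ]) = ren (copair Γ (∈-++⁺ˡ ∘ ρ) (∈-++⁺ʳ _)) φ [-, b ]

  _∧ᵢ_ : ∀ {Γ} → Instance Γ → Instance Γ → Instance Γ
  _∧ᵢ_ {Γ} (φ [-, b ]) (ψ [-, c ]) =
    (ren (copair Γ ∈-++⁺ˡ (∈-++⁺ʳ Γ ∘ ∈-++⁺ˡ)) φ and
     ren (copair Γ ∈-++⁺ˡ (∈-++⁺ʳ Γ ∘ ∈-++⁺ʳ _)) ψ) [-, ++⁺ b c ]

  ⊩-⊤ : ∀ {Γ} (a : Tuple Γ) → a ⊩ ⊤ᵢ
  ⊩-⊤ a = id

  -- `¬_` ends in the empty type of lowest level, `neg` in the polymorphic one; this passes between
  -- them.
  ⊩-¬ : ∀ {Γ} {φ : Instance Γ} {a} → (¬ a ⊩ φ) ⇔ a ⊩ ¬ᵢ φ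
  ⊩-¬ = mk⇔ (λ ¬h h → contradiction h ¬h) (λ ¬h h → ⊥-elim (¬h h))

  ⊩-ren : ∀ {Γ Δ} (ρ : Γ ⇒ Δ) φ {b a} → b ≈[ ρ ] a → b ⊩ φ ⇔ a ⊩ renᵢ ρ φ
  ⊩-ren {Γ} ρ (φ [-, c ]) {b} {a} e = Sat-ren N _ φ
    (≈-copair b {c} {++⁺ a c} (λ i → trans (e i) (lookup-++⁺ˡ a c (ρ i))) (lookup-++⁺ʳ a c))

  ⊩-∧ : ∀ {Γ} (φ ψ : Instance Γ) {a} → (a ⊩ φ × a ⊩ ψ) ⇔ a ⊩ φ ∧ᵢ ψ
  ⊩-∧ (φ [-, b ]) (ψ [-, c ]) {a} =
    Sat-ren N _ φ (≈-copair a {b} {++⁺ a (++⁺ b c)} (lookup-++⁺ˡ a _)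
      (λ i → trans (lookup-++⁺ˡ b c i) (lookup-++⁺ʳ a _ (∈-++⁺ˡ i)))) ×-⇔
    Sat-ren N _ ψ (≈-copair a {c} {++⁺ a (++⁺ b c)} (lookup-++⁺ˡ a _)
      (λ i → trans (lookup-++⁺ʳ b c i) (lookup-++⁺ʳ a _ (∈-++⁺ʳ _ i))))

  module _ {D : Subset} where

    entries-[] : entries [] ⊆ D
    entries-[] (() , _)

    entries-∷ : ∀ {Γ σ} {x : Carrier σ} {a : Tuple Γ} → (σ , x) ∈ D → entries a ⊆ D → entries (x ∷ a) ⊆ D
    entries-∷ x∈D a⊆D (here refl , refl) = x∈D
    entries-∷ x∈D a⊆D (there i   , refl) = a⊆D (i , refl)

    entries-single : ∀ {σ} {x : Carrier σ} → (σ , x) ∈ D → entries (x ∷ []) ⊆ D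
    entries-single x∈D (here refl , refl) = x∈D

    entries-++ : ∀ {Γ Δ} (a : Tuple Γ) {b : Tuple Δ} →
                 entries a ⊆ D → entries b ⊆ D → entries (++⁺ a b) ⊆ D
    entries-++ []      a⊆D b⊆D e = b⊆D e
    entries-++ (x ∷ a) {b} a⊆D b⊆D = entries-∷ {a = ++⁺ a b} (a⊆D (here refl , refl))
      (entries-++ a (λ (i , e) → a⊆D (there i , e)) b⊆D)

  entries-tail : ∀ {Γ σ} {x : Carrier σ} {a : Tuple Γ} → entries a ⊆ entries (x ∷ a)
  entries-tail (i , e) = there i , e

  -- Equality with a tuple as a formula with parameters. It shows that a set lies in its algebraic
  -- closure, fixes known coordinates of a type and, negated, omits a given tuple.
  is : ∀ {Γ} → Tuple Γ → Instance Γ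
  is []              = ⊤ᵢ
  is (_∷_ {σ} {Γ} x b) =
    (eq (var (here refl)) (var (there (∈-++⁺ʳ Γ (here refl)))) [-, x ∷ [] ]) ∧ᵢ renᵢ there (is b)

  is-over : ∀ {Γ} (b : Tuple Γ) → Over (entries b) (is b)
  is-over []      = entries-[] {D = entries []}
  is-over (x ∷ b) = entries-++ {D = D} (x ∷ [])
    (entries-single {D = D} (here refl , refl)) (entries-tail {a = b} ∘ is-over b)
    where D = entries (x ∷ b)

  ⊩-is : ∀ {Γ} (b : Tuple Γ) {a} → a ≡ b ⇔ a ⊩ is b
  ⊩-is []      {[]}    = mk⇔ (λ _ → ⊩-⊤ []) (λ _ → refl)
  ⊩-is (x ∷ b) {z ∷ a} = mk⇔
    (λ { refl → to (⊩-∧ point rest {x ∷ b}) (x≡ b , to (shift {b}) (to (⊩-is b) refl)) })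
    (λ h → let (p , q) = from (⊩-∧ point rest {z ∷ a}) h in
      cong₂ _∷_ (trans p (sym (x≡ a))) (from (⊩-is b) (from (shift {a}) q)))
    where
    point = eq (var (here refl)) (var (there (∈-++⁺ʳ _ (here refl)))) [-, x ∷ [] ]
    rest  = renᵢ there (is b)
    x≡ : ∀ (a : Tuple _) → x ≡ All.lookup (++⁺ a (x ∷ [])) (∈-++⁺ʳ _ (here refl))
    x≡ a = lookup-++⁺ʳ a (x ∷ []) (here refl)
    shift : ∀ {a y} → a ⊩ is b ⇔ (y ∷ a) ⊩ rest
    shift = ⊩-ren there (is b) λ i → refl

  ∪-small : {A B : Subset} → Small A → Small B → Small (A ∪ B)
  ∪-small (I , f , A⊆ , A⊇) (J , g , B⊆ , B⊇) = (I ⊎ J) , [ f , g ] ,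
    (λ { (inj₁ x) → let (i , e) = A⊆ x in inj₁ i , e
       ; (inj₂ x) → let (j , e) = B⊆ x in inj₂ j , e }) ,
    λ { (inj₁ i , e) → inj₁ (A⊇ (i , e)) ; (inj₂ j , e) → inj₂ (B⊇ (j , e)) }

  entries-small : ∀ {Γ} (a : Tuple Γ) → Small (entries a)
  entries-small {Γ} a = (∃[ σ ] σ ∈ₗ Γ) , (λ (σ , i) → σ , All.lookup a i) ,
    (λ { (i , refl) → (_ , i) , refl }) , λ { ((σ , i) , refl) → i , refl }

  Algebraic-mono : ∀ {Γ} {a : Tuple Γ} {C D : Subset} → C ⊆ D → Algebraic a C → Algebraic a D
  Algebraic-mono C⊆D (φ , o , h , fin) = φ , C⊆D ∘ o , h , fin

  acl-mono : {C D : Subset} → C ⊆ D → acl C ⊆ acl D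
  acl-mono {C} {D} C⊆D = Algebraic-mono {C = C} {D} C⊆D

  ⊆-acl : {C : Subset} → C ⊆ acl C
  ⊆-acl {x = _ , x} x∈C = is (x ∷ []) , entries-single x∈C ∘ is-over (x ∷ []) ,
    to (⊩-is (x ∷ [])) refl , (x ∷ []) ∷ [] , λ a h → here (from (⊩-is (x ∷ [])) h)

  -- The conjunction of a formula for the head and one for the tail has its solutions in the product
  -- of two finite lists.
  entries-acl⇒Algebraic : ∀ {Γ} (b : Tuple Γ) {C} → entries b ⊆ acl C → Algebraic b C
  entries-acl⇒Algebraic []      {C} b⊆ = ⊤ᵢ , entries-[] {D = C} , ⊩-⊤ [] , [] ∷ [] , λ { [] _ → here refl }
  entries-acl⇒Algebraic (x ∷ b) b⊆
    with φ , oφ , hφ , xs , fφ ← b⊆ (here refl , refl)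
       | ψ , oψ , hψ , bs , fψ ← entries-acl⇒Algebraic b (b⊆ ∘ entries-tail {a = b}) =
    φ′ ∧ᵢ ψ′ , entries-++ (params φ) oφ oψ ,
    to (⊩-∧ φ′ ψ′) (to (⊩-φ {x} {b}) hφ , to (⊩-ψ {x} {b}) hψ) ,
    cartesianProductWith (λ z a → All.head z ∷ a) xs bs ,
    λ { (z ∷ a) h → let (p , q) = from (⊩-∧ φ′ ψ′) h in
        ∈-cartesianProductWith⁺ _ (fφ (z ∷ []) (from (⊩-φ {z} {a}) p)) (fψ a (from (⊩-ψ {z} {a}) q)) }
    where
    φ′ = renᵢ (single (here refl)) φ
    ψ′ = renᵢ there ψ
    ⊩-φ : ∀ {z a} → (z ∷ []) ⊩ φ ⇔ (z ∷ a) ⊩ φ′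
    ⊩-φ {z} {a} = ⊩-ren (single (here refl)) φ (≈-single {a = z ∷ a} (here refl) refl)
    ⊩-ψ : ∀ {z a} → a ⊩ ψ ⇔ (z ∷ a) ⊩ ψ′
    ⊩-ψ = ⊩-ren there ψ λ i → refl

  -- Project to one coordinate: the solutions of "some solution of `φ` has `i`-th entry z" are the
  -- `i`-th entries of the finitely many solutions of `φ`.
  Algebraic⇒entries-acl : ∀ {Γ} {b : Tuple Γ} {C} → Algebraic b C → entries b ⊆ acl C
  Algebraic⇒entries-acl {Γ} {b} (φ [-, c ] , o , h , bs , fin) {σ , _} (i , refl) =
    exs Γ χ [-, c ] , o ,
    from (Sat-exs N Γ χ _) (b , to ⊩-φ h , trans (sym (left b)) (right b)) ,
    map (λ a → All.lookup a i ∷ []) bs ,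
    λ { (z ∷ []) s → let (a , p , q) = to (Sat-exs N Γ χ _) s in
        subst (λ y → y ∷ [] ∈ₗ map _ bs) (trans (left a) (trans q (sym (right a))))
          (∈-map⁺ _ (fin a (from ⊩-φ p))) }
    where
    χ = ren (copair Γ ∈-++⁺ˡ (∈-++⁺ʳ Γ ∘ there)) φ and
        eq (var (∈-++⁺ˡ i)) (var (∈-++⁺ʳ Γ (here refl)))
    ⊩-φ : ∀ {a z} → Sat N φ (++⁺ a c) ⇔ Sat N (ren _ φ) (++⁺ a (z ∷ c))
    ⊩-φ {a} {z} = Sat-ren N _ φ
      (≈-copair a {c} {++⁺ a (z ∷ c)} (lookup-++⁺ˡ a (z ∷ c)) (lookup-++⁺ʳ a (z ∷ c) ∘ there))
    left : ∀ a {z} → All.lookup a i ≡ All.lookup (++⁺ a (z ∷ c)) (∈-++⁺ˡ i)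
    left a {z} = lookup-++⁺ˡ a (z ∷ c) i
    right : ∀ a {z} → z ≡ All.lookup (++⁺ a (z ∷ c)) (∈-++⁺ʳ Γ (here refl))
    right a {z} = lookup-++⁺ʳ a (z ∷ c) (here refl)

  -- Tuples drawn from a small family

  module _ {X : Set κ} (s : X → Sort) where

    lookup-at : ∀ (f : Family s) {x xs} (p : x ∈ₗ xs) → All.lookup (_at_ s f xs) (∈-map⁺ s p) ≡ f x
    lookup-at f (here refl) = refl
    lookup-at f (there p)   = lookup-at f p

    entries-at : ∀ {D : Subset} (f : Family s) → (∀ x → (s x , f x) ∈ D) → ∀ xs → entries (_at_ s f xs) ⊆ D
    entries-at {D} f f∈D []       = entries-[] {D}
    entries-at {D} f f∈D (x ∷ xs) = entries-∷ {D} {a = _at_ s f xs} (f∈D x) (entries-at {D} f f∈D xs)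

    -- A position in `map s xs` shows only a sort; the recursion on `xs` recovers the variable that
    -- `v` expects.
    reindex : ∀ {Θ} xs → (∀ {x} → x ∈ₗ xs → s x ∈ₗ Θ) → map s xs ⇒ Θ
    reindex (x ∷ xs) v (here refl) = v (here refl)
    reindex (x ∷ xs) v (there i)   = reindex xs (v ∘ there) i

    ≈-reindex : ∀ {Θ} xs {v : ∀ {x} → x ∈ₗ xs → s x ∈ₗ Θ} {f : Family s} {a : Tuple Θ} →
      (∀ {x} (p : x ∈ₗ xs) → f x ≡ All.lookup a (v p)) → _at_ s f xs ≈[ reindex xs v ] a
    ≈-reindex (x ∷ xs) e (here refl) = e (here refl)
    ≈-reindex (x ∷ xs) {a = a} e (there i) = ≈-reindex xs {a = a} (e ∘ there) i

    range : Family s → Subset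
    range f e = ∃[ x ] (s x , f x) ≡ e

    -- Sorts and entries are equated together, as a pair, because the sorts agree with `map s xs`
    -- only propositionally.
    range-tuple : ∀ (f : Family s) {Γ} (a : Tuple Γ) → entries a ⊆ range f →
      Σ[ xs ∈ List X ] (Γ , a) ≡ (map s xs , _at_ s f xs)
    range-tuple f []      a⊆ = [] , refl
    range-tuple f (z ∷ a) a⊆
      with x , refl ← a⊆ (here refl , refl)
         | xs , refl ← range-tuple f a (λ (i , e) → a⊆ (there i , e)) = x ∷ xs , refl

    -- Meant for the parameters of a formula over A′C′: those from the family will become variables,
    -- those from `C` stay parameters. The two kinds may be interleaved, hence the renaming `ρ`.
    split-tuple : ∀ (f : Family s) {C : Subset} {Γ} (a : Tuple Γ) → entries a ⊆ range f ∪ C →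
      Σ[ xs ∈ List X ] Σ[ Δ ∈ List Sort ] Σ[ c ∈ Tuple Δ ] entries c ⊆ C ×
      Σ[ ρ ∈ (Γ ⇒ map s xs ++ Δ) ] a ≈[ ρ ] ++⁺ (_at_ s f xs) c
    split-tuple f {C} [] a⊆ = [] , [] , [] , entries-[] {C} , (λ ()) , λ ()
    split-tuple f {C} (z ∷ a) a⊆
      with xs , Δ , c , c⊆ , ρ , e ← split-tuple f {C} a (λ (i , e) → a⊆ (there i , e))
         | a⊆ (here refl , refl)
    ... | inj₁ (x , refl) = x ∷ xs , Δ , c , c⊆ , copair (s x ∷ []) (single (here refl)) (there ∘ ρ) ,
      ≈-copair (z ∷ []) {a} {z ∷ ++⁺ (_at_ s f xs) c}
        (≈-single {a = z ∷ ++⁺ (_at_ s f xs) c} (here refl) refl) e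
    ... | inj₂ z∈C = xs , _ ∷ Δ , z ∷ c , entries-∷ {C} {a = c} z∈C c⊆ ,
      copair (_ ∷ []) (single (∈-++⁺ʳ (map s xs) (here refl))) (skip ∘ ρ) ,
      ≈-copair (z ∷ []) {a} {fz}
        (≈-single {a = fz} (∈-++⁺ʳ (map s xs) (here refl))
          (lookup-++⁺ʳ (_at_ s f xs) (z ∷ c) (here refl)))
        (λ i → trans (e i) (≈-copair (_at_ s f xs) {c} {fz} (lookup-++⁺ˡ (_at_ s f xs) (z ∷ c))
          (lookup-++⁺ʳ (_at_ s f xs) (z ∷ c) ∘ there) (ρ i)))
      where
      fz = ++⁺ (_at_ s f xs) (z ∷ c)
      skip = copair (map s xs) ∈-++⁺ˡ (∈-++⁺ʳ (map s xs) ∘ there)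

-- Realising types in tuples

module _ {κ m : Level} {L : Language κ} (N : Structure L m) (em : ∀ {p} → ExcludedMiddle p) where
  open Language L
  open Structure N
  open Big N
  open Instance

  -- Saturation speaks of families indexed by a type, and a tuple is the family indexed by its
  -- positions. Each formula is rewritten in the variables `positions Γ`.
  realise-tuple : Saturated → ∀ {Γ} {D : Subset} → Small D → (P : Pred (Instance Γ) (κ ⊔ m)) →
    (∀ {θ} → θ ∈ P → Over D θ) → (∀ θs → All (_∈ P) θs → Σ[ a ∈ Tuple Γ ] All (a ⊩_) θs) →
    Σ[ a ∈ Tuple Γ ] (∀ θ → θ ∈ P → a ⊩ θ)
  realise-tuple sat {Γ} {D} small P over finsat = tuple f , λ θ θ∈P →
    from (⊩-ren N at-position θ (tuple≈ f)) (f⊩ _ (θ , θ∈P , refl))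
    where
    X = ∃[ σ ] σ ∈ₗ Γ
    s : X → Sort
    s = proj₁
    at-position : Γ ⇒ map s (positions Γ)
    at-position i = ∈-map⁺ s (∈-positions i)
    tuple : Family s → Tuple Γ
    tuple f = All.tabulate (λ i → f (_ , i))
    spread : Instance Γ → FamilyInstance s
    spread θ = positions Γ , renᵢ N at-position θ
    lookup≈ : ∀ (f : Family s) {σ} (i : σ ∈ₗ Γ) →
      f (_ , i) ≡ All.lookup (_at_ s f (positions Γ)) (at-position i)
    lookup≈ f i = sym (lookup-at N s f (∈-positions i))
    tuple≈ : ∀ f → tuple f ≈[ at-position ] _at_ s f (positions Γ)
    tuple≈ f i = trans (lookup-tabulate Γ _ i) (lookup≈ f i)
    p : Pred (FamilyInstance s) (κ ⊔ m)
    p q = Σ[ θ ∈ Instance Γ ] θ ∈ P × q ≡ spread θ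
    unspread : ∀ φs → All (_∈ p) φs → Σ[ θs ∈ List (Instance Γ) ] All (_∈ P) θs ×
      (∀ f a → a ≈[ at-position ] _at_ s f (positions Γ) → All (a ⊩_) θs → All (Realises s f) φs)
    unspread [] [] = [] , [] , λ _ _ _ _ → []
    unspread (_ ∷ φs) ((θ , θ∈P , refl) ∷ ps) with θs , θs∈P , h ← unspread φs ps =
      θ ∷ θs , θ∈P ∷ θs∈P ,
      λ { f a e (a⊩θ ∷ a⊩θs) → to (⊩-ren N at-position θ e) a⊩θ ∷ h f a e a⊩θs }
    finsat′ : FinitelySatisfiable s p
    finsat′ φs φs∈p with θs , θs∈P , h ← unspread φs φs∈p with a , a⊩θs ← finsat θs θs∈P =
      let g = λ (_ , i) → All.lookup a i in g , h g a (lookup≈ g) a⊩θs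
    realisation = sat s D small p (λ { (θ , θ∈P , refl) → over θ∈P }) finsat′
    f = proj₁ realisation
    f⊩ = proj₂ realisation

  -- Instead of one type in k copies of the variables, the realisations are
  -- found one at a time, each avoiding the previous ones.
  fresh-realisation : Saturated → ∀ {Γ} (b : Tuple Γ) {D} → Small D → ¬ Algebraic b D →
    (ys : List (Tuple Γ)) → Σ[ y ∈ Tuple Γ ] RealisesType b D y × y ∉ₗ ys
  fresh-realisation sat {Γ} b {D} small nonalg ys =
    let (y , y⊩) = realise-tuple sat (D∪-small ys) P over finsat
    in y , (λ φ o b⊩φ → y⊩ φ (inj₁ (o , b⊩φ))) ,
       λ y∈ys → from (⊩-¬ N {φ = is N y}) (y⊩ _ (inj₂ (y , y∈ys , refl))) (to (⊩-is N y) refl)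
    where
    D∪_ : List (Tuple Γ) → Subset
    D∪_ = foldr (λ y S → entries y ∪ S) D
    D∪-small : ∀ ys → Small (D∪ ys)
    D∪-small []       = small
    D∪-small (y ∷ ys) = ∪-small N (entries-small N y) (D∪-small ys)
    ⊆-D∪ : ∀ ys → D ⊆ D∪ ys
    ⊆-D∪ []       e = e
    ⊆-D∪ (y ∷ ys) e = inj₂ (⊆-D∪ ys e)
    ∈-D∪ : ∀ {y} ys → y ∈ₗ ys → entries y ⊆ D∪ ys
    ∈-D∪ (y ∷ ys) (here refl) e = inj₁ e
    ∈-D∪ (y ∷ ys) (there i)   e = inj₂ (∈-D∪ ys i e)
    P : Pred (Instance Γ) (κ ⊔ m)
    P θ = (Over D θ × b ⊩ θ) ⊎ (Σ[ y ∈ Tuple Γ ] y ∈ₗ ys × θ ≡ ¬ᵢ_ N (is N y))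
    over : ∀ {θ} → θ ∈ P → Over (D∪ ys) θ
    over (inj₁ (o , _)) e = ⊆-D∪ ys (o e)
    over (inj₂ (y , y∈ys , refl)) e = ∈-D∪ ys y∈ys (is-over N y e)
    -- The formulas true of `b` are collected into one `θ`; the negated equations all follow from
    -- `a ∉ₗ ys`.
    conj : ∀ θs → All (_∈ P) θs → Σ[ θ ∈ Instance Γ ] Over D θ × b ⊩ θ ×
      (∀ a → a ⊩ θ → a ∉ₗ ys → All (a ⊩_) θs)
    conj [] [] = ⊤ᵢ N , entries-[] N {D = D} , ⊩-⊤ N b , λ _ _ _ → []
    conj (φ ∷ θs) (φ∈P ∷ ps) with θ , o , b⊩θ , h ← conj θs ps | φ∈P
    ... | inj₁ (oφ , b⊩φ) = _∧ᵢ_ N φ θ , entries-++ N (params φ) oφ o , to (⊩-∧ N φ θ) (b⊩φ , b⊩θ) ,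
      λ a a⊩ a∉ys → let (a⊩φ , a⊩θ) = from (⊩-∧ N φ θ) a⊩ in a⊩φ ∷ h a a⊩θ a∉ys
    ... | inj₂ (y , y∈ys , refl) = θ , o , b⊩θ ,
      λ a a⊩θ a∉ys →
        to (⊩-¬ N {φ = is N y})
          (λ a⊩is → a∉ys (subst (_∈ₗ ys) (sym (from (⊩-is N y) a⊩is)) y∈ys)) ∷
        h a a⊩θ a∉ys
    finsat : ∀ θs → All (_∈ P) θs → Σ[ a ∈ Tuple Γ ] All (a ⊩_) θs
    finsat θs ps with θ , o , b⊩θ , h ← conj θs ps with em {P = Σ[ a ∈ Tuple Γ ] a ⊩ θ × a ∉ₗ ys}
    ... | yes (a , a⊩θ , a∉ys) = a , h a a⊩θ a∉ys
    -- Otherwise `ys` would list all solutions of `θ`, a formula over `D` that holds of `b`.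
    ... | no  none = contradiction {A = Algebraic b D}
      (θ , o , b⊩θ , ys , λ a a⊩θ → decidable-stable em λ a∉ys → none (a , a⊩θ , a∉ys)) nonalg

  DistinctRealisations : ∀ {Γ} → ℕ → Tuple Γ → Subset → Set (κ ⊔ m)
  DistinctRealisations {Γ} k b D =
    Σ[ ys ∈ (Fin k → Tuple Γ) ] Injective _≡_ _≡_ ys × (∀ i → RealisesType b D (ys i))

  distinct-realisations : Saturated → ∀ {Γ} (b : Tuple Γ) {D} → Small D → ¬ Algebraic b D →
    ∀ k → DistinctRealisations k b D
  distinct-realisations sat b small nonalg zero = (λ ()) , (λ { {()} }) , λ ()
  distinct-realisations sat {Γ} b {D} small nonalg (suc k) =
    extend (distinct-realisations sat b small nonalg k)
    where
    extend : DistinctRealisations k b D → DistinctRealisations (suc k) b D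
    extend (ys , inj , real) = ys′ , inj′ , λ { zero → proj₁ (proj₂ fresh) ; (suc i) → real i }
      where
      fresh = fresh-realisation sat b small nonalg (tabulate ys)
      ys′ : Fin (suc k) → Tuple Γ
      ys′ zero    = proj₁ fresh
      ys′ (suc i) = ys i
      new : ∀ i → ys i ≢ proj₁ fresh
      new i e = proj₂ (proj₂ fresh) (subst (_∈ₗ tabulate ys) e (∈-tabulate⁺ i))
      inj′ : Injective _≡_ _≡_ ys′
      inj′ {zero}  {zero}  _ = refl
      inj′ {zero}  {suc j} e = contradiction (sym e) (new j)
      inj′ {suc i} {zero}  e = contradiction e (new i)
      inj′ {suc i} {suc j} e = cong suc (inj e)

  -- From independence to non-forking

  ⊥ᴹ⇒¬dividing : Saturated → ∀ {A B C} → Small C → A ⊥ᴹ[ C ] B →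
    ∀ {Γ Δ} (a : Tuple Γ) (ψ : Instance Γ) (c : Tuple Δ) →
    entries a ⊆ A → entries (params ψ) ⊆ B → entries c ⊆ B →
    StronglyDivides ψ (C ∪ entries c) → ¬ a ⊩ ψ
  ⊥ᴹ⇒¬dividing sat {A} {B} {C} C-small A⊥B {Γ} a (φ [-, d ]) c a⊆A d⊆B c⊆B (nonalg , k , incons) a⊩ψ =
    -- M-independence is applied with `E` as the intermediate set. That `d` lies in the closure of
    -- `B ∪ E` is immediate; the other closure is `d⊆aclAE`.
    nonalg (entries-acl⇒Algebraic N d λ e → proj₁ (A⊥B E inj₁ E⊆acl) (d⊆aclAE e , ⊆-acl N (inj₁ (d⊆B e))))
    where
    E D : Subset
    E = C ∪ entries c
    D = E ∪ entries a
    E⊆acl : E ⊆ acl (B ∪ C)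
    E⊆acl = ⊆-acl N ∘ [ inj₂ , inj₁ ∘ c⊆B ]
    D-small : Small D
    D-small = ∪-small N (∪-small N C-small (entries-small N c)) (entries-small N a)
    -- Variables and parameters change places, so that the type of `d` over `D` contains this
    -- formula.
    flipped = ren (copair Γ (∈-++⁺ʳ _) ∈-++⁺ˡ) φ [-, a ]
    ⊩-flipped : ∀ {d} → a ⊩ φ [-, d ] ⇔ d ⊩ flipped
    ⊩-flipped {d} = Sat-ren N _ φ (≈-copair a {d} {++⁺ d a} (lookup-++⁺ʳ d a) (lookup-++⁺ˡ d a))
    algebraic : Algebraic d D
    -- Realisations of the type over `D` also realise the type over `E`, and all satisfy `flipped`;
    -- `k` distinct ones make `a` a common solution against `incons`.
    algebraic = decidable-stable em λ ¬alg →
      let (ds , inj , real) = distinct-realisations sat d {D} D-small ¬alg k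
      in incons ds inj (λ i θ o → real i θ (inj₁ ∘ o))
           (a , λ i → from ⊩-flipped (real i flipped inj₂ (to ⊩-flipped a⊩ψ)))
    d⊆aclAE : entries d ⊆ acl (A ∪ E)
    d⊆aclAE e = acl-mono N {D} {A ∪ E} [ inj₂ , inj₁ ∘ a⊆A ] (Algebraic⇒entries-acl N algebraic e)

  preimage-tuple : ∀ (h : Automorphism) {A′ A : Subset} → A ⊆ Automorphism.image h A′ →
    ∀ {Γ} (a : Tuple Γ) → entries a ⊆ A →
    Σ[ a′ ∈ Tuple Γ ] entries a′ ⊆ A′ × All.map (Automorphism.to h) a′ ≡ a
  preimage-tuple h {A′} A⊆ []      a⊆A = [] , entries-[] N {A′} , refl
  preimage-tuple h {A′} {A} A⊆ (x ∷ a) a⊆A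
    with x′ , x′∈A′ , refl ← A⊆ (a⊆A (here refl , refl))
       | a′ , a′⊆A′ , refl ← preimage-tuple h {A′} {A} A⊆ a (λ (i , e) → a⊆A (there i , e)) =
    x′ ∷ a′ , entries-∷ N {A′} {a = a′} x′∈A′ a′⊆A′ , refl

  map-fixes : ∀ (h : Automorphism) {B : Subset} →
    (∀ {σ} (x : Carrier σ) → (σ , x) ∈ B → Automorphism.to h x ≡ x) →
    ∀ {Γ} (b : Tuple Γ) → entries b ⊆ B → All.map (Automorphism.to h) b ≡ b
  map-fixes h fix []      b⊆B = refl
  map-fixes h {B} fix (x ∷ b) b⊆B =
    cong₂ _∷_ (fix x (b⊆B (here refl , refl))) (map-fixes h {B} fix b (λ (i , e) → b⊆B (there i , e)))

  map-++⁺ : (h : ∀ {σ} → Carrier σ → Carrier σ) → ∀ {Γ Δ} (a : Tuple Γ) (b : Tuple Δ) →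
            All.map h (++⁺ a b) ≡ ++⁺ (All.map h a) (All.map h b)
  map-++⁺ h []      b = refl
  map-++⁺ h (x ∷ a) b = cong (h x ∷_) (map-++⁺ h a b)

  module _ {C : Subset} {Γ : List Sort} where

    -- The set to be used as B̂. The recursion is on the proofs of þ-dividing, since these carry the
    -- witnesses `c`.
    support : Subset → {ψs : List (Instance Γ)} → All (λ ψ → ÞDivides ψ C) ψs → Subset
    support B []                               = B
    support B (_∷_ {x = ψ} (_ , c , _) ps) = (entries (params ψ) ∪ entries c) ∪ support B ps

    support-small : ∀ {B} → Small B → {ψs : List (Instance Γ)} (ps : All (λ ψ → ÞDivides ψ C) ψs) →
                    Small (support B ps)
    support-small B-small []                             = B-small
    support-small B-small (_∷_ {x = ψ} (_ , c , _) ps) =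
      ∪-small N (∪-small N (entries-small N (params ψ)) (entries-small N c)) (support-small B-small ps)

    ⊆-support : ∀ {B} {ψs : List (Instance Γ)} (ps : All (λ ψ → ÞDivides ψ C) ψs) → B ⊆ support B ps
    ⊆-support []       e = e
    ⊆-support (_ ∷ ps) e = inj₂ (⊆-support ps e)

    ⊥ᴹ⇒¬Any : Saturated → ∀ {A B B̂} → Small C → A ⊥ᴹ[ C ] B̂ →
      ∀ {ψs} (ps : All (λ ψ → ÞDivides ψ C) ψs) → support B ps ⊆ B̂ →
      (a : Tuple Γ) → entries a ⊆ A → ¬ Any (a ⊩_) ψs
    ⊥ᴹ⇒¬Any sat {A} {B} {B̂} small A⊥B̂ (_∷_ {x = ψ} (_ , c , sd) ps) ⊆B̂ a a⊆A (here a⊩ψ) =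
      ⊥ᴹ⇒¬dividing sat {A} {B̂} {C} small A⊥B̂ a ψ c a⊆A (⊆B̂ ∘ inj₁ ∘ inj₁) (⊆B̂ ∘ inj₁ ∘ inj₂) sd a⊩ψ
    ⊥ᴹ⇒¬Any sat {A} {B} {B̂} small A⊥B̂ (_ ∷ ps) ⊆B̂ a a⊆A (there any) =
      ⊥ᴹ⇒¬Any sat {A} {B} {B̂} small A⊥B̂ ps (⊆B̂ ∘ inj₂) a a⊆A any

  ⊥þ⇒¬ÞForks : Saturated → ∀ {A B C} → Small B → Small C → A ⊥þ[ C ] B →
    ∀ {Γ Δ} (a : Tuple Γ) (b : Tuple Δ) → entries a ⊆ A → entries b ⊆ B ∪ C →
    (φ : Formula L (Γ ++ Δ)) → a ⊩ φ [-, b ] → ¬ ÞForks (φ [-, b ]) C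
  ⊥þ⇒¬ÞForks sat {A} {B} {C} B-small C-small A⊥B a b a⊆A b⊆BC φ a⊩φ (ψs , ps , cover)
    -- The automorphism maps `A′` onto `A` and fixes `b`, so `a` is pulled back to `a′` in `A′` and
    -- `φ` still holds of `a′` and `b`.
    with A⊥B (support {C} B ps) (support-small {C} B-small ps) (⊆-support {C} ps)
  ... | A′ , (h , fix , _ , A⊆image) , A′⊥ with preimage-tuple h {A′} {A} A⊆image a a⊆A
  ... | a′ , a′⊆A′ , refl =
    ⊥ᴹ⇒¬Any {C} sat {A′} {B} {support {C} B ps} C-small A′⊥ ps id a′ a′⊆A′
      (cover a′ (from (Sat-automorphism N h φ _) (subst (Sat N φ) (sym moved) a⊩φ)))
    where
    moved : All.map (Automorphism.to h) (++⁺ a′ b) ≡ ++⁺ (All.map (Automorphism.to h) a′) b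
    moved = trans (map-++⁺ (Automorphism.to h) a′ b) (cong (++⁺ _) (map-fixes h {B ∪ C} fix b b⊆BC))

  -- From non-forking to independence

  -- Excluded middle for all types also acts as a choice operator.
  solutions : ∀ {Γ} → Instance Γ → List (Tuple Γ)
  solutions φ with em {P = Finite φ}
  ... | yes (as , _) = as
  ... | no  _        = []

  ∈-solutions : ∀ {Γ} (φ : Instance Γ) → Finite φ → ∀ a → a ⊩ φ → a ∈ₗ solutions φ
  ∈-solutions φ fin a h with em {P = Finite φ}
  ... | yes (_ , cover) = cover a h
  ... | no  inf         = contradiction fin inf

  -- Past the end of the list the value is arbitrary; such values only enlarge the bound built in
  -- `acl-bounded`.
  nth : ∀ {σ} → List (Tuple (σ ∷ [])) → ℕ → Carrier σ
  nth []             _       = nonempty _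
  nth ((x ∷ []) ∷ _) zero    = x
  nth (_ ∷ as)       (suc n) = nth as n

  ∈⇒nth : ∀ {σ} {x : Carrier σ} {as} → (x ∷ []) ∈ₗ as → ∃[ n ] nth as n ≡ x
  ∈⇒nth {as = _ ∷ _} (here refl) = zero , refl
  ∈⇒nth {as = (_ ∷ []) ∷ _} (there i) = let (n , e) = ∈⇒nth i in suc n , e

  -- An algebraic element is named by a formula, indices of its parameters and a place in the chosen
  -- list of solutions, and all these names form a type in `Set κ`. A small superset is enough to
  -- apply saturation.
  acl-bounded : ∀ {A} → Small A → Σ[ D ∈ Subset ] Small D × acl A ⊆ D
  acl-bounded {A} (I , g , A⊆ , _) = (λ e → ∃[ j ] enum j ≡ e) , (J , enum , id , id) , covers
    where
    s : I → Sort
    s = proj₁ ∘ g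
    f : Family s
    f = proj₂ ∘ g
    J : Set κ
    J = Σ[ is ∈ List I ] Σ[ σ ∈ Sort ] Formula L (σ ∷ map s is) × ℕ
    enum : J → Elem
    enum (is , σ , φ , n) = σ , nth (solutions (φ [-, _at_ s f is ])) n
    covers : acl A ⊆ λ e → ∃[ j ] enum j ≡ e
    covers {σ , x} (φ [-, c ] , c⊆A , h , fin)
      with is , refl ← range-tuple N s f c (λ e → A⊆ (c⊆A e))
      with n , e ← ∈⇒nth (∈-solutions (φ [-, c ]) fin (x ∷ []) h) = (is , σ , φ , n) , cong (σ ,_) e

  -- The parameters do not change, and a common solution of the renamed formulas restricts along `ρ`
  -- to one of the original formulas. This brings þ-dividing formulas to common variables.
  ÞDivides-ren : ∀ {Γ Δ} (ρ : Γ ⇒ Δ) {ψ : Instance Γ} {C} → ÞDivides ψ C → ÞDivides (renᵢ N ρ ψ) C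
  ÞDivides-ren ρ {φ [-, d ]} (Θ , c , nonalg , k , incons) = Θ , c , nonalg , k ,
    λ ds inj real (a , h) → incons ds inj real
      (All.tabulate (λ i → All.lookup a (ρ i)) ,
       λ i → from (⊩-ren N ρ (φ [-, ds i ]) {a = a} (lookup-tabulate _ _)) (h i))

  module _ {Γ Δ : List Sort} {σ : Sort} (χ : Formula L (σ ∷ (Γ ++ Δ))) (n : ℕ) where
    private
      skip : (Γ ++ Δ) ⇒ (Γ ++ σ ∷ Δ)
      skip = copair Γ ∈-++⁺ˡ (∈-++⁺ʳ Γ ∘ there)

      ≈-skip : ∀ a {x} (c : Tuple Δ) → ++⁺ a c ≈[ skip ] ++⁺ a (x ∷ c)
      ≈-skip a {x} c = ≈-copair a {c} {++⁺ a (x ∷ c)} (lookup-++⁺ˡ a (x ∷ c)) (lookup-++⁺ʳ a (x ∷ c) ∘ there)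

    -- χ(x,y,c) ∧ ∃≤n z χ(z,y,c) in the variables y, with parameters x and c.
    dividing : Formula L (Γ ++ σ ∷ Δ)
    dividing = ren (copair (σ ∷ []) (single (∈-++⁺ʳ Γ (here refl))) skip) χ and ren skip (atMost n χ)

    Sat-dividing : ∀ (a : Tuple Γ) {x} (c : Tuple Δ) →
      (Sat N χ (x ∷ ++⁺ a c) × Sat N (atMost n χ) (++⁺ a c)) ⇔ Sat N dividing (++⁺ a (x ∷ c))
    Sat-dividing a {x} c =
      Sat-ren N _ χ (≈-copair (x ∷ []) {++⁺ a c} {++⁺ a (x ∷ c)}
        (≈-single {a = ++⁺ a (x ∷ c)} _ (lookup-++⁺ʳ a (x ∷ c) (here refl))) (≈-skip a c)) ×-⇔
      Sat-ren N _ (atMost n χ) (≈-skip a c)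

    -- Realisations of the type of xc over Cc differ only in their first coordinate, and each such
    -- coordinate solves χ(z,a,c). As this has at most `n` solutions, `suc n` distinct realisations
    -- are too many.
    dividing-divides : ∀ {C : Subset} (x : Carrier σ) (c : Tuple Δ) → (σ , x) ∉ acl (C ∪ entries c) →
      StronglyDivides (dividing [-, x ∷ c ]) (C ∪ entries c)
    dividing-divides {C} x c x∉acl =
      (λ alg → x∉acl (Algebraic⇒entries-acl N alg (here refl , refl))) , suc n , incons
      where
      -- The formula `is N c` has parameters in `entries c`, so it belongs to the type and
      -- determines the tail.
      tail≡ : ∀ d → RealisesType (x ∷ c) (C ∪ entries c) d → d ≡ All.head d ∷ c
      tail≡ (y ∷ c′) real = cong (y ∷_) (from (⊩-is N c) (from shift
        (real (renᵢ N there (is N c)) (inj₂ ∘ is-over N c) (to shift (to (⊩-is N c) refl)))))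
        where
        shift : ∀ {y c′} → c′ ⊩ is N c ⇔ (y ∷ c′) ⊩ renᵢ N there (is N c)
        shift = ⊩-ren N there (is N c) λ i → refl
      incons : Inconsistent (suc n) (dividing [-, x ∷ c ]) (C ∪ entries c)
      -- The bound on solutions does not mention the realisation; index `zero`, present because
      -- there are `suc n` of them, supplies it.
      incons ds inj real (a , h) = pigeons (to (Sat-atMost N em n χ _) (proj₂ (split zero)))
        where
        y : Fin (suc n) → Carrier σ
        y i = All.head (ds i)
        ds≡ : ∀ i → ds i ≡ y i ∷ c
        ds≡ i = tail≡ (ds i) (real i)
        split : ∀ i → Sat N χ (y i ∷ ++⁺ a c) × Sat N (atMost n χ) (++⁺ a c)
        split i = from (Sat-dividing a c) (subst (λ d → Sat N dividing (++⁺ a d)) (ds≡ i) (h i))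
        pigeons : ¬ (Σ[ ws ∈ List (Carrier σ) ] length ws ≡ n × (∀ z → Sat N χ (z ∷ ++⁺ a c) → z ∈ₗ ws))
        pigeons (ws , refl , cover) =
          let index i       = Any.index (cover (y i) (proj₁ (split i)))
              at-index i    = lookup-index (cover (y i) (proj₁ (split i)))
              (i , j , i<j , e) = pigeonhole (n<1+n (length ws)) index
              yᵢ≡yⱼ = trans (at-index i) (trans (cong (lookup ws) e) (sym (at-index j)))
          in <⇒≢ i<j (inj (trans (ds≡ i) (trans (cong (_∷ c) yᵢ≡yⱼ) (sym (ds≡ j)))))

  module _ {X : Set κ} (s : X → Sort) (f : Family s) {C E : Subset}
           (avoids : ∀ ψ → OverF s E ψ → ÞDivides (proj₂ ψ) C → ¬ Realises s f ψ) where

    -- Two closures are taken because `D` must contain every admissible `C′` before `E` can contain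
    -- every acl(BC′). Then both `x` and the parameters `c` of the dividing formula lie in `E`.
    avoids⇒⊥ᴹ : ∀ {B D : Subset} → acl (B ∪ C) ⊆ D → acl (B ∪ D) ⊆ E → range N s f ⊥ᴹ[ C ] B
    avoids⇒⊥ᴹ {B} {D} aclBC⊆D aclBD⊆E C′ C⊆C′ C′⊆acl =
      (λ {e} (x∈ , x∈′) → decidable-stable em (excluded x∈ x∈′)) ,
      λ x∈ → acl-mono N {C′} {range N s f ∪ C′} inj₂ x∈ , acl-mono N {C′} {B ∪ C′} inj₂ x∈
      where
      C′⊆D : C′ ⊆ D
      C′⊆D e = aclBC⊆D (C′⊆acl e)
      C′⊆E : C′ ⊆ E
      C′⊆E e = aclBD⊆E (⊆-acl N (inj₂ (C′⊆D e)))
      excluded : ∀ {e} → e ∈ acl (range N s f ∪ C′) → e ∈ acl (B ∪ C′) → ¬ (e ∉ acl C′)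
      excluded {σ , x} (φ [-, p ] , p⊆ , h , as , cover) x∈acl′ x∉acl
        with xs , Δ , c , c⊆C′ , ρ , e ← split-tuple N s f {C′} p p⊆ =
        avoids (xs , dividing χ n [-, x ∷ c ])
          (entries-∷ N {E} {a = c}
            (aclBD⊆E (acl-mono N {B ∪ C′} {B ∪ D} [ inj₁ , inj₂ ∘ C′⊆D ] x∈acl′)) (C′⊆E ∘ c⊆C′))
          (Δ , c , dividing-divides χ n {C} x c
            -- Since Cc is contained in `C′`, being outside acl(C′) puts `x` outside acl(Cc).
            (x∉acl ∘ acl-mono N {C ∪ entries c} {C′} [ C⊆C′ , c⊆C′ ]))
          (to (Sat-dividing χ n (_at_ s f xs) c) (to (⊩-χ x) h ,
            from (Sat-atMost N em n χ _) (map All.head as , refl ,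
              λ z sat → ∈-map⁺ All.head (cover (z ∷ []) (from (⊩-χ z) sat)))))
        where
        n = length (map (All.head {P = Carrier} {x = σ} {xs = []}) as)
        χ = ren (lift ρ) φ
        ⊩-χ : ∀ z → (z ∷ []) ⊩ φ [-, p ] ⇔ Sat N χ (z ∷ ++⁺ (_at_ s f xs) c)
        ⊩-χ z = Sat-ren N (lift ρ) φ (≈-lift e)

  -- Finite satisfiability of the type that avoids þ-dividing formulas

  module _ {X : Set κ} (s : X → Sort) where

    private
      -- A list of variables may repeat a variable, so each is read off at one chosen position.
      canonical : ∀ {zs : List X} {x} → x ∈ₗ zs → x ∈ₗ zs
      canonical {zs} {x} p with em {P = x ∈ₗ zs}
      ... | yes q = q
      ... | no  x∉ = contradiction p x∉

      assign : ∀ {zs} → Tuple (map s zs) → Family s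
      assign {zs} a x with em {P = x ∈ₗ zs}
      ... | yes q = All.lookup a (∈-map⁺ s q)
      ... | no  _ = nonempty (s x)

      assign≡ : ∀ {zs} (a : Tuple (map s zs)) {x} (p : x ∈ₗ zs) →
                assign a x ≡ All.lookup a (∈-map⁺ s (canonical p))
      assign≡ {zs} a {x} p with em {P = x ∈ₗ zs}
      ... | yes q = refl
      ... | no  x∉ = contradiction p x∉

      Sub : List X → FamilyInstance s → Set κ
      Sub zs (xs , _) = ∀ x → x ∈ₗ xs → x ∈ₗ zs

      rename : ∀ {xs zs} → (∀ x → x ∈ₗ xs → x ∈ₗ zs) → map s xs ⇒ map s zs
      rename {xs} sub = reindex N s xs (∈-map⁺ s ∘ canonical ∘ sub _)

      variables : List (FamilyInstance s) → List X
      variables = concatMap proj₁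

      ⊆-variables : ∀ φs → All (Sub (variables φs)) φs
      ⊆-variables []            = []
      ⊆-variables ((xs , _) ∷ φs) = (λ _ → ∈-++⁺ˡ) ∷ All.map (λ sub x p → ∈-++⁺ʳ xs (sub x p)) (⊆-variables φs)

    -- tp(f/B) together with ¬ψ for each ψ over E that þ-divides over C.
    AvoidingType : Family s → Subset → Subset → Subset → Pred (FamilyInstance s) (κ ⊔ m)
    AvoidingType f B C E q = (OverF s B q × Realises s f q) ⊎
      (Σ[ ψ ∈ FamilyInstance s ] OverF s E ψ × ÞDivides (proj₂ ψ) C × q ≡ map₂ (¬ᵢ_ N) ψ)

    module _ (f : Family s) (B C E : Subset) where

      -- Forking concerns one formula in one tuple of variables, so a finite part of the type is
      -- moved to the variables `zs`: formulas true of `f` are conjoined into `θ`, the negated ones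
      -- are listed in `ψs`.
      gather : ∀ {zs} φs → All (_∈ AvoidingType f B C E) φs → All (Sub zs) φs →
        Σ[ θ ∈ Instance (map s zs) ] Over B θ × _at_ s f zs ⊩ θ ×
        Σ[ ψs ∈ List (Instance (map s zs)) ] All (λ ψ → ÞDivides ψ C) ψs ×
        (∀ a → a ⊩ θ → ¬ Any (a ⊩_) ψs → All (Realises s (assign a)) φs)
      gather {zs} [] [] [] = ⊤ᵢ N , entries-[] N {B} , ⊩-⊤ N (_at_ s f zs) , [] , [] , λ _ _ _ → []
      gather {zs} ((xs , φ) ∷ φs) (φ∈p ∷ ps) (sub ∷ subs)
        with θ , o , f⊩θ , ψs , divs , h ← gather φs ps subs | φ∈p
      ... | inj₁ (oφ , f⊩φ) =
        _∧ᵢ_ N φ′ θ , entries-++ N {B} (params φ) oφ o ,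
        to (⊩-∧ N φ′ θ) (to (⊩-ren N ρ φ at-zs) f⊩φ , f⊩θ) , ψs , divs ,
        λ a a⊩ ¬any → let (a⊩φ′ , a⊩θ) = from (⊩-∧ N φ′ θ) a⊩ in
          from (⊩-ren N ρ φ (≈-reindex N s xs {a = a} (assign≡ a ∘ sub _))) a⊩φ′ ∷ h a a⊩θ ¬any
        where
        ρ = rename sub
        φ′ = renᵢ N ρ φ
        at-zs : _at_ s f xs ≈[ ρ ] _at_ s f zs
        at-zs = ≈-reindex N s xs {a = _at_ s f zs} (λ p → sym (lookup-at N s f (canonical (sub _ p))))
      ... | inj₂ ((_ , ψ) , _ , div , refl) =
        θ , o , f⊩θ , renᵢ N ρ ψ ∷ ψs , ÞDivides-ren ρ {ψ} div ∷ divs ,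
        λ a a⊩θ ¬any →
          to (⊩-¬ N {φ = ψ}) (λ ⊩ψ → ¬any (here
            (to (⊩-ren N ρ ψ (≈-reindex N s xs {a = a} (assign≡ a ∘ sub _))) ⊩ψ))) ∷
          h a a⊩θ (¬any ∘ there)
        where
        ρ = rename sub

      AvoidingType-satisfiable :
        (∀ zs (θ : Instance (map s zs)) → Over B θ → _at_ s f zs ⊩ θ → ¬ ÞForks θ C) →
        FinitelySatisfiable s (AvoidingType f B C E)
      AvoidingType-satisfiable nonforking φs ps
        with θ , o , f⊩θ , ψs , divs , h ← gather φs ps (⊆-variables φs)
        with em {P = Σ[ a ∈ Tuple _ ] a ⊩ θ × ¬ Any (a ⊩_) ψs}
      ... | yes (a , a⊩θ , ¬any) = assign a , h a a⊩θ ¬any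
      -- If every solution of `θ` satisfied a member of `ψs`, then `θ` would þ-fork over `C`,
      -- although it is over `B` and true of `f`.
      ... | no  none = contradiction
        (ψs , divs , λ a a⊩θ → decidable-stable em λ ¬any → none (a , a⊩θ , ¬any))
        (nonforking _ θ o f⊩θ)

  -- Conjugacy over a set through homogeneity

  lefts : ∀ {I J : Set κ} → List (I ⊎ J) → List I
  lefts = concatMap [ _∷ [] , (λ _ → []) ]

  rights : ∀ {I J : Set κ} → List (I ⊎ J) → List J
  rights = concatMap [ (λ _ → []) , _∷ [] ]

  ∈-lefts : ∀ {I J : Set κ} {i : I} (xs : List (I ⊎ J)) → inj₁ i ∈ₗ xs → i ∈ₗ lefts xs
  ∈-lefts (inj₁ _ ∷ xs) (here refl) = here refl
  ∈-lefts (inj₁ _ ∷ xs) (there p)   = there (∈-lefts xs p)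
  ∈-lefts (inj₂ _ ∷ xs) (there p)   = ∈-lefts xs p

  ∈-rights : ∀ {I J : Set κ} {j : J} (xs : List (I ⊎ J)) → inj₂ j ∈ₗ xs → j ∈ₗ rights xs
  ∈-rights (inj₂ _ ∷ xs) (here refl) = here refl
  ∈-rights (inj₂ _ ∷ xs) (there p)   = there (∈-rights xs p)
  ∈-rights (inj₁ _ ∷ xs) (there p)   = ∈-rights xs p

  -- Homogeneity is stated without parameters. Adjoining an enumeration of the base set to both
  -- families forces the automorphism to fix that set.
  join : ∀ {I J : Set κ} {s : I → Sort} {t : J → Sort} → Family s → Family t → Family [ s , t ]
  join f b (inj₁ i) = f i
  join f b (inj₂ j) = b j

  module _ {I J : Set κ} (s : I → Sort) (t : J → Sort) (b : Family t) {B : Subset}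
           (b∈B : ∀ j → (t j , b j) ∈ B) where

    -- The variables for `b` become parameters, which gives a formula over `B` about the family
    -- alone. One implication suffices because it also applies to the negation.
    SameType-over : ∀ {f f′ : Family s} →
      (∀ φ → OverF s B φ → Realises s f φ → Realises s f′ φ) →
      SameType [ s , t ] (join f′ b) (join f b)
    SameType-over {f} {f′} f⇒f′ xs φ = mk⇔
      (λ h → from (split f) (decidable-stable em λ ¬f →
        from (⊩-¬ N {φ = φ′}) (f⇒f′ (ls , ¬ᵢ_ N φ′) over (to (⊩-¬ N {φ = φ′}) ¬f)) (to (split f′) h)))
      (λ h → from (split f′) (f⇒f′ (ls , φ′) over (to (split f) h)))
      where
      ls = lefts xs
      rs = rights xs
      position : ∀ {x} → x ∈ₗ xs → [ s , t ] x ∈ₗ map s ls ++ map t rs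
      position {inj₁ i} p = ∈-++⁺ˡ (∈-map⁺ s (∈-lefts xs p))
      position {inj₂ j} p = ∈-++⁺ʳ (map s ls) (∈-map⁺ t (∈-rights xs p))
      φ′ : Instance (map s ls)
      φ′ = ren (reindex N [ s , t ] xs position) φ [-, _at_ t b rs ]
      over : Over B φ′
      over = entries-at N t {B} b b∈B rs
      split : ∀ f → Sat N φ (_at_ [ s , t ] (join f b) xs) ⇔ _at_ s f ls ⊩ φ′
      split f = Sat-ren N _ φ (≈-reindex N [ s , t ] xs {a = ++⁺ fs bs} join≡)
        where
        fs = _at_ s f ls
        bs = _at_ t b rs
        join≡ : ∀ {x} (p : x ∈ₗ xs) → join f b x ≡ All.lookup (++⁺ fs bs) (position p)
        join≡ {inj₁ i} p = trans (sym (lookup-at N s f (∈-lefts xs p))) (lookup-++⁺ˡ fs bs _)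
        join≡ {inj₂ j} p = trans (sym (lookup-at N t b (∈-rights xs p))) (lookup-++⁺ʳ fs bs _)

    join-≡ : ∀ {f f′ : Family s} {A : Subset} → A ≐ range N s f → B ⊆ range N t b →
      Σ[ h ∈ Automorphism ] (∀ x → Automorphism.to h (join f′ b x) ≡ join f b x) →
      range N s f′ ≡[ B ] A
    join-≡ {f} {f′} {A} (A⊆ , ⊆A) B⊆ (h , h≡) =
      h , (λ x x∈B → fixes (B⊆ x∈B)) , image⊆A , λ x∈A → ⊆image (A⊆ x∈A)
      where
      fixes : ∀ {σ} {x : Carrier σ} → (σ , x) ∈ range N t b → Automorphism.to h x ≡ x
      fixes (j , refl) = h≡ (inj₂ j)
      image⊆A : Automorphism.image h (range N s f′) ⊆ A
      image⊆A (_ , (i , refl) , refl) = subst (λ x → (s i , x) ∈ A) (sym (h≡ (inj₁ i))) (⊆A (i , refl))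
      ⊆image : range N s f ⊆ Automorphism.image h (range N s f′)
      ⊆image (i , refl) = f′ i , (i , refl) , h≡ (inj₁ i)

  ¬ÞForks⇒⊥þ : Saturated → StronglyHomogeneous → ∀ {A B C} → Small A → Small B → Small C →
    (∀ {Γ Δ} (a : Tuple Γ) (b : Tuple Δ) → entries a ⊆ A → entries b ⊆ B ∪ C →
      (φ : Formula L (Γ ++ Δ)) → a ⊩ φ [-, b ] → ¬ ÞForks (φ [-, b ]) C) →
    A ⊥þ[ C ] B
  ¬ÞForks⇒⊥þ sat hom {A} {B} {C} (I , g , A⊆ , ⊆A) B-small C-small nonforking B̂ B̂-small B⊆B̂
    with J , g′ , BC⊆ , ⊆BC ← ∪-small N B-small C-small
    -- `D` and `E` are small bounds for acl(B̂C) and acl(B̂D), so the avoiding type over BC and `E`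
    -- can be realised by saturation.
    with D , D-small , acl⊆D ← acl-bounded (∪-small N B̂-small C-small)
    with E , E-small , acl⊆E ← acl-bounded (∪-small N B̂-small D-small) =
    range N s f′ ,
    join-≡ s t b (λ j → ⊆BC (j , refl)) {f} {f′} {A} (A⊆ , ⊆A) BC⊆ homogeneity ,
    avoids⇒⊥ᴹ s f′ {C} {E} avoids {B̂} {D} acl⊆D acl⊆E
    where
    s : I → Sort
    s = proj₁ ∘ g
    f : Family s
    f = proj₂ ∘ g
    t : J → Sort
    t = proj₁ ∘ g′
    b : Family t
    b = proj₂ ∘ g′
    p : Pred (FamilyInstance s) (κ ⊔ m)
    p = AvoidingType s f (B ∪ C) C E
    p-over : p ⊆ OverF s ((B ∪ C) ∪ E)
    p-over (inj₁ (o , _)) e = inj₁ (o e)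
    p-over (inj₂ (_ , o , _ , refl)) e = inj₂ (o e)
    satisfiable : FinitelySatisfiable s p
    satisfiable = AvoidingType-satisfiable s f (B ∪ C) C E λ zs θ o →
      nonforking (_at_ s f zs) (params θ)
        (entries-at N s {A} f (λ i → ⊆A (i , refl)) zs) o (formula θ)
    realisation : Σ[ f′ ∈ Family s ] (∀ φ → φ ∈ p → Realises s f′ φ)
    realisation = sat s ((B ∪ C) ∪ E)
      (∪-small N (∪-small N B-small C-small) E-small) p p-over satisfiable
    f′ : Family s
    f′ = proj₁ realisation
    avoids : ∀ ψ → OverF s E ψ → ÞDivides (proj₂ ψ) C → ¬ Realises s f′ ψ
    avoids ψ o div = from (⊩-¬ N {φ = proj₂ ψ})
      (proj₂ realisation (map₂ (¬ᵢ_ N) ψ) (inj₂ (ψ , o , div , refl)))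
    homogeneity : Σ[ h ∈ Automorphism ] (∀ x → Automorphism.to h (join f′ b x) ≡ join f b x)
    homogeneity = hom [ s , t ] (join f′ b) (join f b)
      (SameType-over s t b {B ∪ C} (λ j → ⊆BC (j , refl)) {f} {f′}
        λ φ o f⊩φ → proj₂ realisation φ (inj₁ (o , f⊩φ)))

propositionA2 : (∀ {p : Level} → ExcludedMiddle p) →
    ∀ {ℓ m : Level} (L : Language ℓ) (T : Theory L) →
    Consistent T → Complete T →
    (N : Structure (Eq T) m) → IsModelOfEq T N →
    let open Big N in
    Saturated → StronglyHomogeneous →
    (A B C : Subset) → Small A → Small B → Small C →
    (A ⊥þ[ C ] B) ⇔
    (∀ {Γ Δ : List (Language.Sort (Eq T))} (a : Tuple Γ) (b : Tuple Δ) →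
    entries a ⊆ A → entries b ⊆ B ∪ C →
    (φ : Formula (Eq T) (Γ ++ Δ)) → a ⊩ φ [-, b ] →
    ¬ ÞForks (φ [-, b ]) C)
propositionA2 em L T _ _ N _ sat hom A B C A-small B-small C-small = mk⇔
  (⊥þ⇒¬ÞForks N em sat {A} {B} {C} B-small C-small)
  (¬ÞForks⇒⊥þ N em sat hom {A} {B} {C} A-small B-small C-small)
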